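{- The full simply-typed $\lambda$-calculus $\lambda_{\to,\wedge,\vee,\bot}$ is strongly normalizing: for every term $M$ of $\lambda_{\to,\wedge,\vee,\bot}$ there is no infinite sequence $M = M_0 \to M_1 \to M_2 \to \cdots$, where $\to$ is the union of $\beta$-reduction $\to_\beta$ and commutative (permutative) reduction $\rightsquigarrow$.
   Context: Types of $\lambda_{\to,\wedge,\vee,\bot}$: $\sigma,\tau ::= p, q, \ldots \mid \sigma\to\tau \mid \sigma\wedge\tau \mid \sigma\vee\tau \mid \bot$, where $p,q,\ldots$ are type constants. Terms are in Church style (a superscript indicates the type of a term) and are considered up to $\alpha$-conversion. They are: variables $x^\sigma$; introductions $(\lambda x^\sigma.N^\tau)^{\sigma\to\tau}$, $\langle M^\sigma,N^\tau\rangle^{\sigma\wedge\tau}$, $(\mathtt{in}_1 A^\sigma)^{\sigma\vee\tau}$, $(\mathtt{in}_2 B^\tau)^{\sigma\vee\tau}$; eliminations $(M^{\sigma\to\tau}N^\sigma)^\tau$, $(P^{\sigma\wedge\tau}\pi_1)^\sigma$, $(P^{\sigma\wedge\tau}\pi_2)^\tau$, $(W^{\sigma\vee\tau}[x^\sigma.S^\delta,y^\tau.T^\delta])^\delta$ (case analysis, $x$ bound in $S$ and $y$ bound in $T$), $(A^\bot\epsilon_\tau)^\tau$ (ex falso). An eliminator $E$ is any of: a term $N$ (application), $\pi_1$, $\pi_2$, $[a.A,b.B]$, $\epsilon_\alpha$; an elimination term is written $ME$. $\beta$-rules: $(\lambda x^\tau.M)A \to_\beta M[x:=A]$; $\langle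 M,N\rangle\pi_1\to_\beta M$; $\langle M,N\rangle\pi_2\to_\beta N$; $(\mathtt{in}_1 A)[x.S,y.T]\to_\beta S[x:=A]$; $(\mathtt{in}_2 B)[x.S,y.T]\to_\beta T[y:=B]$. Commutative rules, for every eliminator $E$ such that the left-hand side is well typed (bound variables renamed to avoid capture): (1) $(W[x.S,y.T])E \rightsquigarrow W[x.SE,\,y.TE]$; (2) $(A^\bot\epsilon_\rho)E \rightsquigarrow A\,\epsilon_{\rho'}$, where $\rho'$ is the type of $(A\epsilon_\rho)E$ (this includes $(A\epsilon_\bot)\epsilon_\sigma\rightsquigarrow A\epsilon_\sigma$). Both $\to_\beta$ and $\rightsquigarrow$ denote the compatible closures of these rules, i.e. a rule may be applied to any subterm. -}

module Defs where

open import Data.List.Base using (List; []; _∷_)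
open import Data.List.Membership.Propositional using (_∈_)
open import Data.List.Relation.Unary.Any using (here; there)
open import Level using (0ℓ)
open import Relation.Binary.Core using (Rel)
open import Relation.Binary.Construct.Union using (_∪_)
open import Relation.Binary.PropositionalEquality using (refl)

infixr 7 _⇒_
infixr 8 _∨_
infixr 9 _∧_
infixl 7 _∙_
infix  8 _[_]
infix  4 _▷β_ _▷γ_ _⟶β_ _⇝_ _⟶_

data Ty (Atom : Set) : Set where
  `_  : Atom → Ty Atom
  _⇒_ : Ty Atom → Ty Atom → Ty Atom
  _∧_ : Ty Atom → Ty Atom → Ty Atom
  _∨_ : Ty Atom → Ty Atom → Ty Atom
  ⊥   : Ty Atom

Ctx : Set → Set
Ctx Atom = List (Ty Atom)

variable
  Atom      : Set
  Γ Δ       : Ctx Atom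
  σ τ ρ δ   : Ty Atom

-- Church-style terms up to α-conversion are represented by intrinsically typed
-- de Bruijn terms; Γ lists the types of the variables that may occur free.
-- `Elim Γ σ τ` is the type of the eliminators E such that M E has type τ
-- whenever M has type σ; the elimination term M E is written `M ∙ E`.

data Term {Atom : Set} (Γ : Ctx Atom) : Ty Atom → Set
data Elim {Atom : Set} (Γ : Ctx Atom) : Ty Atom → Ty Atom → Set

data Term {Atom} Γ where
  var   : σ ∈ Γ → Term Γ σ
  lam   : Term (σ ∷ Γ) τ → Term Γ (σ ⇒ τ)
  ⟨_,_⟩ : Term Γ σ → Term Γ τ → Term Γ (σ ∧ τ)
  in₁   : Term Γ σ → Term Γ (σ ∨ τ)
  in₂   : Term Γ τ → Term Γ (σ ∨ τ)
  _∙_   : Term Γ σ → Elim Γ σ τ → Term Γ τ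

data Elim {Atom} Γ where
  app  : Term Γ σ → Elim Γ (σ ⇒ τ) τ
  π₁   : Elim Γ (σ ∧ τ) σ
  π₂   : Elim Γ (σ ∧ τ) τ
  case : Term (σ ∷ Γ) δ → Term (τ ∷ Γ) δ → Elim Γ (σ ∨ τ) δ
  ε    : (τ : Ty Atom) → Elim Γ ⊥ τ

Ren : Ctx Atom → Ctx Atom → Set
Ren Γ Δ = ∀ {σ} → σ ∈ Γ → σ ∈ Δ

Sub : Ctx Atom → Ctx Atom → Set
Sub Γ Δ = ∀ {σ} → σ ∈ Γ → Term Δ σ

liftRen : Ren Γ Δ → Ren (σ ∷ Γ) (σ ∷ Δ)
liftRen r (here p)  = here p
liftRen r (there x) = there (r x)

rename  : Ren Γ Δ → Term Γ σ → Term Δ σ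
renameE : Ren Γ Δ → Elim Γ σ τ → Elim Δ σ τ

rename r (var x)   = var (r x)
rename r (lam M)   = lam (rename (liftRen r) M)
rename r ⟨ M , N ⟩ = ⟨ rename r M , rename r N ⟩
rename r (in₁ M)   = in₁ (rename r M)
rename r (in₂ M)   = in₂ (rename r M)
rename r (M ∙ E)   = rename r M ∙ renameE r E

renameE r (app N)    = app (rename r N)
renameE r π₁         = π₁
renameE r π₂         = π₂
renameE r (case S T) = case (rename (liftRen r) S) (rename (liftRen r) T)
renameE r (ε τ)      = ε τ

weakenE : Elim Γ σ τ → Elim (ρ ∷ Γ) σ τ
weakenE = renameE there

liftSub : Sub Γ Δ → Sub (σ ∷ Γ) (σ ∷ Δ)
liftSub s (here p)  = var (here p)
liftSub s (there x) = rename there (s x)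

subst  : Sub Γ Δ → Term Γ σ → Term Δ σ
substE : Sub Γ Δ → Elim Γ σ τ → Elim Δ σ τ

subst s (var x)   = s x
subst s (lam M)   = lam (subst (liftSub s) M)
subst s ⟨ M , N ⟩ = ⟨ subst s M , subst s N ⟩
subst s (in₁ M)   = in₁ (subst s M)
subst s (in₂ M)   = in₂ (subst s M)
subst s (M ∙ E)   = subst s M ∙ substE s E

substE s (app N)    = app (subst s N)
substE s π₁         = π₁
substE s π₂         = π₂
substE s (case S T) = case (subst (liftSub s) S) (subst (liftSub s) T)
substE s (ε τ)      = ε τ

single : Term Γ σ → Sub (σ ∷ Γ) Γ
single A (here refl) = A
single A (there x)   = var x

_[_] : Term (σ ∷ Γ) τ → Term Γ σ → Term Γ τ
M [ A ] = subst (single A) M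

data _▷β_ {Atom : Set} {Γ : Ctx Atom} : {σ : Ty Atom} → Rel (Term Γ σ) 0ℓ where
  β-⇒  : {M : Term (σ ∷ Γ) τ} {A : Term Γ σ} →
         lam M ∙ app A ▷β M [ A ]
  β-∧₁ : {M : Term Γ σ} {N : Term Γ τ} →
         ⟨ M , N ⟩ ∙ π₁ ▷β M
  β-∧₂ : {M : Term Γ σ} {N : Term Γ τ} →
         ⟨ M , N ⟩ ∙ π₂ ▷β N
  β-∨₁ : {A : Term Γ σ} {S : Term (σ ∷ Γ) δ} {T : Term (τ ∷ Γ) δ} →
         in₁ A ∙ case S T ▷β S [ A ]
  β-∨₂ : {B : Term Γ τ} {S : Term (σ ∷ Γ) δ} {T : Term (τ ∷ Γ) δ} →
         in₂ B ∙ case S T ▷β T [ B ]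

data _▷γ_ {Atom : Set} {Γ : Ctx Atom} : {σ : Ty Atom} → Rel (Term Γ σ) 0ℓ where
  γ-∨ : {W : Term Γ (σ ∨ τ)} {S : Term (σ ∷ Γ) δ} {T : Term (τ ∷ Γ) δ}
        {E : Elim Γ δ ρ} →
        W ∙ case S T ∙ E ▷γ W ∙ case (S ∙ weakenE E) (T ∙ weakenE E)
  γ-⊥ : {A : Term Γ ⊥} {E : Elim Γ ρ τ} →
        A ∙ ε ρ ∙ E ▷γ A ∙ ε τ

module Compatible {Atom : Set}
  (_▷_ : {Γ : Ctx Atom} {σ : Ty Atom} → Rel (Term Γ σ) 0ℓ) where

  data Closure  {Γ : Ctx Atom} : {σ : Ty Atom} → Rel (Term Γ σ) 0ℓ
  data ClosureE {Γ : Ctx Atom} : {σ τ : Ty Atom} → Rel (Elim Γ σ τ) 0ℓ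

  data Closure {Γ} where
    rule  : {M N : Term Γ σ} → M ▷ N → Closure M N
    lam   : {M M′ : Term (σ ∷ Γ) τ} →
            Closure M M′ → Closure (lam M) (lam M′)
    pairˡ : {M M′ : Term Γ σ} {N : Term Γ τ} →
            Closure M M′ → Closure ⟨ M , N ⟩ ⟨ M′ , N ⟩
    pairʳ : {M : Term Γ σ} {N N′ : Term Γ τ} →
            Closure N N′ → Closure ⟨ M , N ⟩ ⟨ M , N′ ⟩
    in₁   : {M M′ : Term Γ σ} →
            Closure M M′ → Closure (in₁ {τ = τ} M) (in₁ M′)
    in₂   : {M M′ : Term Γ τ} →
            Closure M M′ → Closure (in₂ {σ = σ} M) (in₂ M′)
    elimˡ : {M M′ : Term Γ σ} {E : Elim Γ σ τ} →
            Closure M M′ → Closure (M ∙ E) (M′ ∙ E)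
    elimʳ : {M : Term Γ σ} {E E′ : Elim Γ σ τ} →
            ClosureE E E′ → Closure (M ∙ E) (M ∙ E′)

  data ClosureE {Γ} where
    app   : {N N′ : Term Γ σ} →
            Closure N N′ → ClosureE (app {τ = τ} N) (app N′)
    caseˡ : {S S′ : Term (σ ∷ Γ) δ} {T : Term (τ ∷ Γ) δ} →
            Closure S S′ → ClosureE (case S T) (case S′ T)
    caseʳ : {S : Term (σ ∷ Γ) δ} {T T′ : Term (τ ∷ Γ) δ} →
            Closure T T′ → ClosureE (case S T) (case S T′)

_⟶β_ : Rel (Term Γ σ) 0ℓ
_⟶β_ = Compatible.Closure _▷β_

_⇝_ : Rel (Term Γ σ) 0ℓ
_⇝_ = Compatible.Closure _▷γ_

_⟶_ : Rel (Term Γ σ) 0ℓ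
_⟶_ = _⟶β_ ∪ _⇝_

{-# OPTIONS --safe #-}

-- Reducibility with elimination stacks.  A term is reducible if it is strongly
-- normalizing when put in front of every good stack of eliminators, where
-- goodness of a stack is defined by recursion on the type of its hole.  For
-- σ ∨ τ, a stack case S T ◅ K is good if S [ A ] and T [ B ] are strongly
-- normalizing in front of K for all reducible A and B; this imposes nothing on
-- the result type δ, so the recursion is well founded.  A permutative step
-- leaves S [ A ] ⋆ K unchanged and shortens the stack behind the case analysis,
-- which provides the termination measure.  All reducibility arguments take place
-- in a fixed context with a variable z of type ⊥: then every type has the
-- reducible inhabitant z ∙ ε σ, so that strong normalization under a binder
-- follows from that of an instance, and no Kripke-style quantification over
-- renamings is needed.
module Submission where

open import Data.List.Base using (_∷_)
open import Data.List.Membership.Propositional using (_∈_)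
open import Data.List.Relation.Unary.Any using (here; there)
open import Data.Nat.Base using (ℕ; zero; suc)
open import Data.Product.Base using (Σ-syntax; _×_; _,_)
open import Data.Sum.Base using (inj₁; inj₂)
open import Data.Unit.Base using (⊤; tt)
open import Function.Base using (_∘_; flip; id)
open import Induction.InfiniteDescent using (descent∧acc⇒unsatisfiable)
open import Induction.WellFounded using (Acc; acc; acc-inverse; module Subrelation)
open import Level using (0ℓ)
open import Relation.Binary.Construct.Closure.ReflexiveTransitive
  using (Star; _◅_; _◅◅_; gmap) renaming (ε to [])
import Relation.Binary.Construct.On as On
open import Relation.Binary.Construct.Union using (_∪_)
open import Relation.Binary.Core using (Rel)
open import Relation.Binary.PropositionalEquality
  using (_≡_; refl; sym; trans; cong; cong₂; subst₂) renaming (subst to ≡-subst)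
open import Relation.Nullary.Negation using (¬_)
open import Defs
open Compatible

private
  variable
    Θ  : Ctx Atom
    δ′ : Ty Atom

-- Substitution

-- Pointwise hypotheses replace the equalities between substitutions that would
-- require function extensionality.

liftSub-var : {s : Sub Γ Γ} → (∀ {σ} (x : σ ∈ Γ) → s x ≡ var x) →
              ∀ {σ} (x : σ ∈ ρ ∷ Γ) → liftSub s x ≡ var x
liftSub-var h (here refl) = refl
liftSub-var h (there x)   = cong (rename there) (h x)

subst-var  : (s : Sub Γ Γ) → (∀ {σ} (x : σ ∈ Γ) → s x ≡ var x) →
             (M : Term Γ τ) → subst s M ≡ M
substE-var : (s : Sub Γ Γ) → (∀ {σ} (x : σ ∈ Γ) → s x ≡ var x) →
             (E : Elim Γ σ τ) → substE s E ≡ E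

subst-var s h (var x)   = h x
subst-var s h (lam M)   = cong lam (subst-var (liftSub s) (liftSub-var h) M)
subst-var s h ⟨ M , N ⟩ = cong₂ ⟨_,_⟩ (subst-var s h M) (subst-var s h N)
subst-var s h (in₁ M)   = cong in₁ (subst-var s h M)
subst-var s h (in₂ M)   = cong in₂ (subst-var s h M)
subst-var s h (M ∙ E)   = cong₂ _∙_ (subst-var s h M) (substE-var s h E)

substE-var s h (app N)    = cong app (subst-var s h N)
substE-var s h π₁         = refl
substE-var s h π₂         = refl
substE-var s h (case S T) = cong₂ case (subst-var (liftSub s) (liftSub-var h) S)
                                       (subst-var (liftSub s) (liftSub-var h) T)
substE-var s h (ε τ)      = refl

module _ {r : Ren Γ Δ} {s : Sub Γ Δ} where

  liftSub-ren : (∀ {σ} (x : σ ∈ Γ) → var (r x) ≡ s x) →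
                ∀ {σ} (x : σ ∈ ρ ∷ Γ) → var (liftRen r x) ≡ liftSub s x
  liftSub-ren h (here refl) = refl
  liftSub-ren h (there x)   = cong (rename there) (h x)

rename≡subst   : (r : Ren Γ Δ) (s : Sub Γ Δ) → (∀ {σ} (x : σ ∈ Γ) → var (r x) ≡ s x) →
                 (M : Term Γ τ) → rename r M ≡ subst s M
renameE≡substE : (r : Ren Γ Δ) (s : Sub Γ Δ) → (∀ {σ} (x : σ ∈ Γ) → var (r x) ≡ s x) →
                 (E : Elim Γ σ τ) → renameE r E ≡ substE s E

rename≡subst r s h (var x)   = h x
rename≡subst r s h (lam M)   = cong lam (rename≡subst (liftRen r) (liftSub s) (liftSub-ren h) M)
rename≡subst r s h ⟨ M , N ⟩ = cong₂ ⟨_,_⟩ (rename≡subst r s h M) (rename≡subst r s h N)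
rename≡subst r s h (in₁ M)   = cong in₁ (rename≡subst r s h M)
rename≡subst r s h (in₂ M)   = cong in₂ (rename≡subst r s h M)
rename≡subst r s h (M ∙ E)   = cong₂ _∙_ (rename≡subst r s h M) (renameE≡substE r s h E)

renameE≡substE r s h (app N)    = cong app (rename≡subst r s h N)
renameE≡substE r s h π₁         = refl
renameE≡substE r s h π₂         = refl
renameE≡substE r s h (case S T) =
  cong₂ case (rename≡subst (liftRen r) (liftSub s) (liftSub-ren h) S)
             (rename≡subst (liftRen r) (liftSub s) (liftSub-ren h) T)
renameE≡substE r s h (ε τ)      = refl

module _ {r : Ren Γ Δ} {s : Sub Δ Θ} {t : Sub Γ Θ} where

  liftSub-∘-ren : (∀ {σ} (x : σ ∈ Γ) → s (r x) ≡ t x) →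
                  ∀ {σ} (x : σ ∈ ρ ∷ Γ) → liftSub s (liftRen r x) ≡ liftSub t x
  liftSub-∘-ren h (here refl) = refl
  liftSub-∘-ren h (there x)   = cong (rename there) (h x)

subst-rename   : (r : Ren Γ Δ) (s : Sub Δ Θ) (t : Sub Γ Θ) →
                 (∀ {σ} (x : σ ∈ Γ) → s (r x) ≡ t x) →
                 (M : Term Γ τ) → subst s (rename r M) ≡ subst t M
substE-renameE : (r : Ren Γ Δ) (s : Sub Δ Θ) (t : Sub Γ Θ) →
                 (∀ {σ} (x : σ ∈ Γ) → s (r x) ≡ t x) →
                 (E : Elim Γ σ τ) → substE s (renameE r E) ≡ substE t E

subst-rename r s t h (var x)   = h x
subst-rename r s t h (lam M)   =
  cong lam (subst-rename (liftRen r) (liftSub s) (liftSub t) (liftSub-∘-ren h) M)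
subst-rename r s t h ⟨ M , N ⟩ = cong₂ ⟨_,_⟩ (subst-rename r s t h M) (subst-rename r s t h N)
subst-rename r s t h (in₁ M)   = cong in₁ (subst-rename r s t h M)
subst-rename r s t h (in₂ M)   = cong in₂ (subst-rename r s t h M)
subst-rename r s t h (M ∙ E)   = cong₂ _∙_ (subst-rename r s t h M) (substE-renameE r s t h E)

substE-renameE r s t h (app N)    = cong app (subst-rename r s t h N)
substE-renameE r s t h π₁         = refl
substE-renameE r s t h π₂         = refl
substE-renameE r s t h (case S T) =
  cong₂ case (subst-rename (liftRen r) (liftSub s) (liftSub t) (liftSub-∘-ren h) S)
             (subst-rename (liftRen r) (liftSub s) (liftSub t) (liftSub-∘-ren h) T)
substE-renameE r s t h (ε τ)      = refl

-- Both sides are the single substitution `var ∘ there ∘ r` applied to `M`; passing through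
-- substitutions spares a separate fusion law for two renamings.
rename-weaken : (r : Ren Γ Δ) (M : Term Γ τ) →
                rename (liftRen {σ = ρ} r) (rename there M) ≡ rename there (rename r M)
rename-weaken r M =
  trans (rename≡subst (liftRen r) (var ∘ liftRen r) (λ _ → refl) (rename there M))
  (trans (subst-rename there (var ∘ liftRen r) (var ∘ there ∘ r) (λ _ → refl) M)
  (sym
  (trans (rename≡subst there (var ∘ there) (λ _ → refl) (rename r M))
         (subst-rename r (var ∘ there) (var ∘ there ∘ r) (λ _ → refl) M))))

module _ {r : Ren Δ Θ} {s : Sub Γ Δ} {t : Sub Γ Θ} where

  liftRen-∘-sub : (∀ {σ} (x : σ ∈ Γ) → rename r (s x) ≡ t x) →
                  ∀ {σ} (x : σ ∈ ρ ∷ Γ) → rename (liftRen r) (liftSub s x) ≡ liftSub t x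
  liftRen-∘-sub h (here refl) = refl
  liftRen-∘-sub h (there x)   = trans (rename-weaken r (s x)) (cong (rename there) (h x))

rename-subst   : (r : Ren Δ Θ) (s : Sub Γ Δ) (t : Sub Γ Θ) →
                 (∀ {σ} (x : σ ∈ Γ) → rename r (s x) ≡ t x) →
                 (M : Term Γ τ) → rename r (subst s M) ≡ subst t M
renameE-substE : (r : Ren Δ Θ) (s : Sub Γ Δ) (t : Sub Γ Θ) →
                 (∀ {σ} (x : σ ∈ Γ) → rename r (s x) ≡ t x) →
                 (E : Elim Γ σ τ) → renameE r (substE s E) ≡ substE t E

rename-subst r s t h (var x)   = h x
rename-subst r s t h (lam M)   =
  cong lam (rename-subst (liftRen r) (liftSub s) (liftSub t) (liftRen-∘-sub h) M)
rename-subst r s t h ⟨ M , N ⟩ = cong₂ ⟨_,_⟩ (rename-subst r s t h M) (rename-subst r s t h N)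
rename-subst r s t h (in₁ M)   = cong in₁ (rename-subst r s t h M)
rename-subst r s t h (in₂ M)   = cong in₂ (rename-subst r s t h M)
rename-subst r s t h (M ∙ E)   = cong₂ _∙_ (rename-subst r s t h M) (renameE-substE r s t h E)

renameE-substE r s t h (app N)    = cong app (rename-subst r s t h N)
renameE-substE r s t h π₁         = refl
renameE-substE r s t h π₂         = refl
renameE-substE r s t h (case S T) =
  cong₂ case (rename-subst (liftRen r) (liftSub s) (liftSub t) (liftRen-∘-sub h) S)
             (rename-subst (liftRen r) (liftSub s) (liftSub t) (liftRen-∘-sub h) T)
renameE-substE r s t h (ε τ)      = refl

subst-weaken : (s : Sub Γ Δ) (M : Term Γ τ) →
               subst (liftSub {σ = ρ} s) (rename there M) ≡ rename there (subst s M)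
subst-weaken s M =
  trans (subst-rename there (liftSub s) (rename there ∘ s) (λ _ → refl) M)
        (sym (rename-subst there s (rename there ∘ s) (λ _ → refl) M))

substE-weakenE : (s : Sub Γ Δ) (E : Elim Γ σ τ) →
                 substE (liftSub {σ = ρ} s) (weakenE E) ≡ weakenE (substE s E)
substE-weakenE s E =
  trans (substE-renameE there (liftSub s) (rename there ∘ s) (λ _ → refl) E)
        (sym (renameE-substE there s (rename there ∘ s) (λ _ → refl) E))

module _ {s : Sub Γ Δ} {t : Sub Δ Θ} {u : Sub Γ Θ} where

  liftSub-∘ : (∀ {σ} (x : σ ∈ Γ) → subst t (s x) ≡ u x) →
              ∀ {σ} (x : σ ∈ ρ ∷ Γ) → subst (liftSub t) (liftSub s x) ≡ liftSub u x
  liftSub-∘ h (here refl) = refl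
  liftSub-∘ h (there x)   = trans (subst-weaken t (s x)) (cong (rename there) (h x))

subst-subst   : (s : Sub Γ Δ) (t : Sub Δ Θ) (u : Sub Γ Θ) →
                (∀ {σ} (x : σ ∈ Γ) → subst t (s x) ≡ u x) →
                (M : Term Γ τ) → subst t (subst s M) ≡ subst u M
substE-substE : (s : Sub Γ Δ) (t : Sub Δ Θ) (u : Sub Γ Θ) →
                (∀ {σ} (x : σ ∈ Γ) → subst t (s x) ≡ u x) →
                (E : Elim Γ σ τ) → substE t (substE s E) ≡ substE u E

subst-subst s t u h (var x)   = h x
subst-subst s t u h (lam M)   =
  cong lam (subst-subst (liftSub s) (liftSub t) (liftSub u) (liftSub-∘ h) M)
subst-subst s t u h ⟨ M , N ⟩ = cong₂ ⟨_,_⟩ (subst-subst s t u h M) (subst-subst s t u h N)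
subst-subst s t u h (in₁ M)   = cong in₁ (subst-subst s t u h M)
subst-subst s t u h (in₂ M)   = cong in₂ (subst-subst s t u h M)
subst-subst s t u h (M ∙ E)   = cong₂ _∙_ (subst-subst s t u h M) (substE-substE s t u h E)

substE-substE s t u h (app N)    = cong app (subst-subst s t u h N)
substE-substE s t u h π₁         = refl
substE-substE s t u h π₂         = refl
substE-substE s t u h (case S T) =
  cong₂ case (subst-subst (liftSub s) (liftSub t) (liftSub u) (liftSub-∘ h) S)
             (subst-subst (liftSub s) (liftSub t) (liftSub u) (liftSub-∘ h) T)
substE-substE s t u h (ε τ)      = refl

weaken-[] : (A : Term Γ ρ) (M : Term Γ τ) → rename there M [ A ] ≡ M
weaken-[] A M =
  trans (subst-rename there (single A) var (λ _ → refl) M) (subst-var var (λ _ → refl) M)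

weakenE-[] : (A : Term Γ ρ) (E : Elim Γ σ τ) → substE (single A) (weakenE E) ≡ E
weakenE-[] A E =
  trans (substE-renameE there (single A) var (λ _ → refl) E) (substE-var var (λ _ → refl) E)

extend : Term Δ σ → Sub Γ Δ → Sub (σ ∷ Γ) Δ
extend A s (here refl) = A
extend A s (there x)   = s x

-- Turns an instantiated body back into a term under one closing substitution, the form in which the
-- induction hypothesis for reducibility applies.
subst-liftSub-[] : (s : Sub Γ Δ) (M : Term (σ ∷ Γ) τ) (A : Term Δ σ) →
                   subst (liftSub s) M [ A ] ≡ subst (extend A s) M
subst-liftSub-[] s M A = subst-subst (liftSub s) (single A) (extend A s)
  (λ { (here refl) → refl ; (there x) → weaken-[] A (s x) }) M

subst-[] : (s : Sub Γ Δ) (M : Term (σ ∷ Γ) τ) (A : Term Γ σ) →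
           subst s (M [ A ]) ≡ subst (liftSub s) M [ subst s A ]
subst-[] s M A =
  trans (subst-subst (single A) s (extend (subst s A) s)
          (λ { (here refl) → refl ; (there x) → refl }) M)
        (sym (subst-liftSub-[] s M (subst s A)))

-- Reduction

infix 4 _▷_ _↦_ _↦E_ _↦*_ _↦ˢ_

_▷_ : Rel (Term Γ σ) 0ℓ
_▷_ = _▷β_ ∪ _▷γ_

-- One closure of the united rules replaces the union of two closures, so that every congruence case
-- is treated once.
_↦_ : Rel (Term Γ σ) 0ℓ
_↦_ = Closure _▷_

_↦E_ : Rel (Elim Γ σ τ) 0ℓ
_↦E_ = ClosureE _▷_

_↦*_ : Rel (Term Γ σ) 0ℓ
_↦*_ = Star _↦_

SN : Term Γ σ → Set
SN = Acc (flip _↦_)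

module _ {R S : {Γ : Ctx Atom} {σ : Ty Atom} → Rel (Term Γ σ) 0ℓ}
         (R⊆S : ∀ {Γ σ} {M N : Term Γ σ} → R M N → S M N) where

  Closure-mono  : {M N : Term Γ σ} → Closure R M N → Closure S M N
  ClosureE-mono : {E F : Elim Γ σ τ} → ClosureE R E F → ClosureE S E F

  Closure-mono (rule q)  = rule (R⊆S q)
  Closure-mono (lam q)   = lam (Closure-mono q)
  Closure-mono (pairˡ q) = pairˡ (Closure-mono q)
  Closure-mono (pairʳ q) = pairʳ (Closure-mono q)
  Closure-mono (in₁ q)   = in₁ (Closure-mono q)
  Closure-mono (in₂ q)   = in₂ (Closure-mono q)
  Closure-mono (elimˡ q) = elimˡ (Closure-mono q)
  Closure-mono (elimʳ q) = elimʳ (ClosureE-mono q)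

  ClosureE-mono (app q)   = app (Closure-mono q)
  ClosureE-mono (caseˡ q) = caseˡ (Closure-mono q)
  ClosureE-mono (caseʳ q) = caseʳ (Closure-mono q)

⟶⇒↦ : {M N : Term Γ σ} → M ⟶ N → M ↦ N
⟶⇒↦ (inj₁ q) = Closure-mono inj₁ q
⟶⇒↦ (inj₂ q) = Closure-mono inj₂ q

SN-↦* : {M N : Term Γ σ} → SN M → M ↦* N → SN N
SN-↦* h       []       = h
SN-↦* (acc h) (q ◅ qs) = SN-↦* (h q) qs

-- Every reduction path from `M` is mapped step by step to one from `f M`. It serves to undo
-- substitutions.
SN-reflect : {f : Term Γ σ → Term Δ τ} → (∀ {M N} → M ↦ N → f M ↦ f N) →
             {M : Term Γ σ} → SN (f M) → SN M
SN-reflect {f = f} f-mono h = Subrelation.accessible f-mono (On.accessible f h)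

subst-▷ : (s : Sub Γ Δ) {M N : Term Γ σ} → M ▷ N → subst s M ▷ subst s N
subst-▷ s (inj₁ (β-⇒ {M = M} {A}))      rewrite subst-[] s M A = inj₁ β-⇒
subst-▷ s (inj₁ β-∧₁)                   = inj₁ β-∧₁
subst-▷ s (inj₁ β-∧₂)                   = inj₁ β-∧₂
subst-▷ s (inj₁ (β-∨₁ {A = A} {S}))     rewrite subst-[] s S A = inj₁ β-∨₁
subst-▷ s (inj₁ (β-∨₂ {B = B} {T = T})) rewrite subst-[] s T B = inj₁ β-∨₂
subst-▷ s (inj₂ (γ-∨ {σ = σ} {τ = τ} {E = E}))
  rewrite substE-weakenE {ρ = σ} s E | substE-weakenE {ρ = τ} s E = inj₂ γ-∨
subst-▷ s (inj₂ γ-⊥)                    = inj₂ γ-⊥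

subst-↦   : (s : Sub Γ Δ) {M N : Term Γ σ} → M ↦ N → subst s M ↦ subst s N
substE-↦E : (s : Sub Γ Δ) {E F : Elim Γ σ τ} → E ↦E F → substE s E ↦E substE s F

subst-↦ s (rule q)  = rule (subst-▷ s q)
subst-↦ s (lam q)   = lam (subst-↦ (liftSub s) q)
subst-↦ s (pairˡ q) = pairˡ (subst-↦ s q)
subst-↦ s (pairʳ q) = pairʳ (subst-↦ s q)
subst-↦ s (in₁ q)   = in₁ (subst-↦ s q)
subst-↦ s (in₂ q)   = in₂ (subst-↦ s q)
subst-↦ s (elimˡ q) = elimˡ (subst-↦ s q)
subst-↦ s (elimʳ q) = elimʳ (substE-↦E s q)

substE-↦E s (app q)   = app (subst-↦ s q)
substE-↦E s (caseˡ q) = caseˡ (subst-↦ (liftSub s) q)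
substE-↦E s (caseʳ q) = caseʳ (subst-↦ (liftSub s) q)

rename-↦ : (r : Ren Γ Δ) {M N : Term Γ σ} → M ↦ N → rename r M ↦ rename r N
rename-↦ r {M} {N} q =
  subst₂ _↦_ (sym (rename≡subst r (var ∘ r) (λ _ → refl) M))
             (sym (rename≡subst r (var ∘ r) (λ _ → refl) N))
             (subst-↦ (var ∘ r) q)

module _ {s t : Sub Γ Δ} where

  liftSub-↦* : (∀ {σ} (x : σ ∈ Γ) → s x ↦* t x) →
               ∀ {σ} (x : σ ∈ ρ ∷ Γ) → liftSub s x ↦* liftSub t x
  liftSub-↦* h (here refl) = []
  liftSub-↦* h (there x)   = gmap (rename there) (rename-↦ there) (h x)

-- A variable may occur any number of times in `M`, so a single step in its image becomes zero or
-- more steps.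
subst-↦*   : (s t : Sub Γ Δ) → (∀ {σ} (x : σ ∈ Γ) → s x ↦* t x) →
             (M : Term Γ τ) → subst s M ↦* subst t M
substE-↦E* : (s t : Sub Γ Δ) → (∀ {σ} (x : σ ∈ Γ) → s x ↦* t x) →
             (E : Elim Γ σ τ) → Star _↦E_ (substE s E) (substE t E)

subst-↦* s t h (var x)   = h x
subst-↦* s t h (lam M)   =
  gmap lam lam (subst-↦* (liftSub s) (liftSub t) (liftSub-↦* h) M)
subst-↦* s t h ⟨ M , N ⟩ = gmap ⟨_, subst s N ⟩ pairˡ (subst-↦* s t h M)
                        ◅◅ gmap ⟨ subst t M ,_⟩ pairʳ (subst-↦* s t h N)
subst-↦* s t h (in₁ M)   = gmap in₁ in₁ (subst-↦* s t h M)
subst-↦* s t h (in₂ M)   = gmap in₂ in₂ (subst-↦* s t h M)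
subst-↦* s t h (M ∙ E)   = gmap (_∙ substE s E) elimˡ (subst-↦* s t h M)
                        ◅◅ gmap (subst t M ∙_) elimʳ (substE-↦E* s t h E)

substE-↦E* s t h (app N)    = gmap app app (subst-↦* s t h N)
substE-↦E* s t h π₁         = []
substE-↦E* s t h π₂         = []
substE-↦E* s t h (case S T) =
     gmap (λ S′ → case S′ (subst (liftSub s) T)) caseˡ
          (subst-↦* (liftSub s) (liftSub t) (liftSub-↦* h) S)
  ◅◅ gmap (case (subst (liftSub t) S)) caseʳ
          (subst-↦* (liftSub s) (liftSub t) (liftSub-↦* h) T)
substE-↦E* s t h (ε τ)      = []

[]-↦ˡ : (A : Term Γ σ) {M N : Term (σ ∷ Γ) τ} → M ↦ N → M [ A ] ↦ N [ A ]
[]-↦ˡ A = subst-↦ (single A)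

[]-↦ʳ : (M : Term (σ ∷ Γ) τ) {A B : Term Γ σ} → A ↦ B → M [ A ] ↦* M [ B ]
[]-↦ʳ M {A} {B} q = subst-↦* (single A) (single B)
  (λ { (here refl) → q ◅ [] ; (there x) → [] }) M

-- Elimination stacks

-- An evaluation context with hole of type `σ`, as a composable chain of eliminators with the
-- innermost one first.
Stack : (Γ : Ctx Atom) → Rel (Ty Atom) 0ℓ
Stack Γ = Star (Elim Γ)

infixl 6 _⋆_

_⋆_ : Term Γ σ → Stack Γ σ ρ → Term Γ ρ
M ⋆ []      = M
M ⋆ (E ◅ K) = M ∙ E ⋆ K

-- A permutative redex consists of two adjacent eliminators, whatever term stands before them, so
-- permutations are steps of the stack alone.
data _↦ˢ_ {Atom : Set} {Γ : Ctx Atom} : {σ ρ : Ty Atom} → Rel (Stack Γ σ ρ) 0ℓ where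
  head : {E F : Elim Γ σ τ} {K : Stack Γ τ ρ} → E ↦E F → E ◅ K ↦ˢ F ◅ K
  tail : {E : Elim Γ σ τ} {K L : Stack Γ τ ρ} → K ↦ˢ L → E ◅ K ↦ˢ E ◅ L
  γ-∨  : {S : Term (σ ∷ Γ) δ} {T : Term (τ ∷ Γ) δ} {E : Elim Γ δ δ′} {K : Stack Γ δ′ ρ} →
         case S T ◅ E ◅ K ↦ˢ case (S ∙ weakenE E) (T ∙ weakenE E) ◅ K
  γ-⊥  : {E : Elim Γ σ τ} {K : Stack Γ τ ρ} → ε σ ◅ E ◅ K ↦ˢ ε τ ◅ K

SNˢ : Stack Γ σ ρ → Set
SNˢ = Acc (flip _↦ˢ_)

⋆-↦ˡ : (K : Stack Γ σ ρ) {M N : Term Γ σ} → M ↦ N → M ⋆ K ↦ N ⋆ K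
⋆-↦ˡ []      q = q
⋆-↦ˡ (E ◅ K) q = ⋆-↦ˡ K (elimˡ q)

⋆-↦ʳ : (M : Term Γ σ) {K L : Stack Γ σ ρ} → K ↦ˢ L → M ⋆ K ↦ M ⋆ L
⋆-↦ʳ M (head {K = K} q) = ⋆-↦ˡ K (elimʳ q)
⋆-↦ʳ M (tail {E = E} q) = ⋆-↦ʳ (M ∙ E) q
⋆-↦ʳ M (γ-∨ {K = K})    = ⋆-↦ˡ K (rule (inj₂ γ-∨))
⋆-↦ʳ M (γ-⊥ {K = K})    = ⋆-↦ˡ K (rule (inj₂ γ-⊥))

data ⋆-Step {Γ : Ctx Atom} (M : Term Γ σ) : Stack Γ σ ρ → Term Γ ρ → Set where
  term  : {N : Term Γ σ} {K : Stack Γ σ ρ} → M ↦ N → ⋆-Step M K (N ⋆ K)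
  stack : {K L : Stack Γ σ ρ} → K ↦ˢ L → ⋆-Step M K (M ⋆ L)
  redex : {E : Elim Γ σ τ} {K : Stack Γ τ ρ} {N : Term Γ τ} →
          M ∙ E ▷ N → ⋆-Step M (E ◅ K) (N ⋆ K)

⋆-step : (M : Term Γ σ) (K : Stack Γ σ ρ) {P : Term Γ ρ} → M ⋆ K ↦ P → ⋆-Step M K P
⋆-step M []      q = term q
⋆-step M (E ◅ K) q with ⋆-step (M ∙ E) K q
... | term (rule q′)   = redex q′
... | term (elimˡ q′)  = term q′
... | term (elimʳ q′)  = stack (head q′)
... | stack q′         = stack (tail q′)
-- `M ∙ E` is no introduction, so against the next eliminator it can only form a permutative redex,
-- which lies within the stack.
... | redex (inj₂ γ-∨) = stack γ-∨
... | redex (inj₂ γ-⊥) = stack γ-⊥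

-- Strong normalization of stacks and head redexes

-- A variable forms no redex with the first eliminator, so all steps take place in the stack.
SN-var : (x : σ ∈ Γ) {K : Stack Γ σ ρ} → SNˢ K → SN (var x ⋆ K)
SN-var {Γ = Γ} {ρ = ρ} x {K} (acc h) = acc λ q → reduct (⋆-step (var x) K q)
  where
  reduct : {P : Term Γ ρ} → ⋆-Step (var x) K P → SN P
  reduct (term (rule (inj₁ ())))
  reduct (term (rule (inj₂ ())))
  reduct (stack q) = SN-var x (h q)
  reduct (redex (inj₁ ()))
  reduct (redex (inj₂ ()))

SNˢ-[] : SNˢ {Γ = Γ} {σ = σ} []
SNˢ-[] = acc λ ()

SNˢ-app : {N : Term Γ σ} {K : Stack Γ τ ρ} → SN N → SNˢ K → SNˢ (app N ◅ K)
SNˢ-app (acc n) (acc k) = acc λ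
  { (head (app q)) → SNˢ-app (n q) (acc k)
  ; (tail q)       → SNˢ-app (acc n) (k q) }

SNˢ-π₁ : {K : Stack Γ σ ρ} → SNˢ K → SNˢ (π₁ {τ = τ} ◅ K)
SNˢ-π₁ (acc k) = acc λ { (tail q) → SNˢ-π₁ (k q) }

SNˢ-π₂ : {K : Stack Γ τ ρ} → SNˢ K → SNˢ (π₂ {σ = σ} ◅ K)
SNˢ-π₂ (acc k) = acc λ { (tail q) → SNˢ-π₂ (k q) }

-- The map f accounts for the eliminators that ε has already absorbed.
SNˢ-ε-absorb : (K : Stack Γ σ ρ) (f : Stack Γ σ ρ → Stack Γ τ ρ) →
               (∀ {L L′} → L ↦ˢ L′ → f L ↦ˢ f L′) → SNˢ (f K) → SNˢ (ε σ ◅ K)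
SNˢ-ε-step   : (K : Stack Γ σ ρ) (f : Stack Γ σ ρ → Stack Γ τ ρ) →
               (∀ {L L′} → L ↦ˢ L′ → f L ↦ˢ f L′) → SNˢ (f K) →
               ∀ {L} → ε σ ◅ K ↦ˢ L → SNˢ L

SNˢ-ε-absorb K f f-mono h = acc (SNˢ-ε-step K f f-mono h)

SNˢ-ε-step K       f f-mono (acc h) (tail q) = SNˢ-ε-absorb _ f f-mono (h (f-mono q))
-- `E` moves from the stack into `f`, so `h` is unchanged and the recursion descends on `K`; in the
-- `tail` case it descends on `h`.
SNˢ-ε-step (E ◅ K) f f-mono h       γ-⊥      =
  SNˢ-ε-absorb K (f ∘ (E ◅_)) (f-mono ∘ tail) h

SNˢ-ε : {K : Stack Γ σ ρ} → SNˢ K → SNˢ (ε σ ◅ K)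
SNˢ-ε h = SNˢ-ε-absorb _ id id h

-- Moving `E` into a branch commutes with instantiating the branch, because the bound variable does
-- not occur in the weakened `E`.
∙-weaken-[] : (M : Term (σ ∷ Γ) δ) (A : Term Γ σ) (E : Elim Γ δ τ) (K : Stack Γ τ ρ) →
              (M ∙ weakenE E) [ A ] ⋆ K ≡ M [ A ] ⋆ (E ◅ K)
∙-weaken-[] M A E K = cong (λ F → M [ A ] ∙ F ⋆ K) (weakenE-[] A E)

-- X and Y are kept as separate terms because a permutative step preserves
-- S [ A ] ⋆ K only up to a propositional equality.
SNˢ-case      : {S : Term (σ ∷ Γ) δ} {T : Term (τ ∷ Γ) δ} (K : Stack Γ δ ρ)
                (A : Term Γ σ) (B : Term Γ τ) {X Y : Term Γ ρ} → SN X → SN Y →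
                S [ A ] ⋆ K ≡ X → T [ B ] ⋆ K ≡ Y → SNˢ (case S T ◅ K)
SNˢ-case-step : {S : Term (σ ∷ Γ) δ} {T : Term (τ ∷ Γ) δ} (K : Stack Γ δ ρ)
                (A : Term Γ σ) (B : Term Γ τ) {X Y : Term Γ ρ} → SN X → SN Y →
                S [ A ] ⋆ K ≡ X → T [ B ] ⋆ K ≡ Y → ∀ {L} → case S T ◅ K ↦ˢ L → SNˢ L

SNˢ-case K A B x y S≡X T≡Y = acc (SNˢ-case-step K A B x y S≡X T≡Y)

SNˢ-case-step K A B (acc x) y refl T≡Y (head (caseˡ q)) =
  SNˢ-case K A B (x (⋆-↦ˡ K ([]-↦ˡ A q))) y refl T≡Y
SNˢ-case-step K A B x (acc y) S≡X refl (head (caseʳ q)) =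
  SNˢ-case K A B x (y (⋆-↦ˡ K ([]-↦ˡ B q))) S≡X refl
-- The new stack need not be structurally smaller than `K`, but its step occurs in both instances,
-- so both accessibility proofs descend.
SNˢ-case-step {S = S} {T} K A B (acc x) (acc y) refl refl (tail q) =
  SNˢ-case _ A B (x (⋆-↦ʳ (S [ A ]) q)) (y (⋆-↦ʳ (T [ B ]) q)) refl refl
-- Here `x` and `y` stay fixed and only the stack behind the case analysis gets shorter.
SNˢ-case-step {S = S} {T} (E ◅ K) A B x y S≡X T≡Y γ-∨ =
  SNˢ-case K A B x y (trans (∙-weaken-[] S A E K) S≡X) (trans (∙-weaken-[] T B E K) T≡Y)

-- Head expansion. Steps of `A` can vanish in `M [ A ]`, so the induction runs on the accessibility
-- of `M` and of the stack, while that of the contractum is carried along.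
SN-lam : {M : Term (σ ∷ Γ) τ} {A : Term Γ σ} {K : Stack Γ τ ρ} →
         SN M → SNˢ (app A ◅ K) → SN (M [ A ] ⋆ K) → SN (lam M ∙ app A ⋆ K)
SN-lam {Γ = Γ} {ρ = ρ} {M = M} {A} {K} (acc m) (acc k) x =
  acc λ q → reduct (⋆-step (lam M) (app A ◅ K) q)
  where
  reduct : {P : Term Γ ρ} → ⋆-Step (lam M) (app A ◅ K) P → SN P
  reduct (term (rule (inj₁ ())))
  reduct (term (rule (inj₂ ())))
  reduct (term (lam q)) =
    SN-lam {K = K} (m q) (acc k) (acc-inverse x (⋆-↦ˡ K ([]-↦ˡ A q)))
  -- The step in the argument is copied or erased by substitution, so the contractum follows it in
  -- several steps or none.
  reduct (stack q@(head (app q′))) =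
    SN-lam {K = K} (acc m) (k q) (SN-↦* x (gmap (_⋆ K) (⋆-↦ˡ K) ([]-↦ʳ M q′)))
  reduct (stack q@(tail {L = L} q′)) =
    SN-lam {K = L} (acc m) (k q) (acc-inverse x (⋆-↦ʳ (M [ A ]) q′))
  reduct (redex (inj₁ β-⇒)) = x

-- Steps of `M` and of `K` are visible in `M ⋆ K`; only the discarded component needs a hypothesis
-- of its own.
SN-pair₁ : {M : Term Γ σ} {N : Term Γ τ} {K : Stack Γ σ ρ} →
           SN (M ⋆ K) → SN N → SN (⟨ M , N ⟩ ∙ π₁ ⋆ K)
SN-pair₁ {Γ = Γ} {ρ = ρ} {M = M} {N} {K} (acc m) (acc n) =
  acc λ q → reduct (⋆-step ⟨ M , N ⟩ (π₁ ◅ K) q)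
  where
  reduct : {P : Term Γ ρ} → ⋆-Step ⟨ M , N ⟩ (π₁ ◅ K) P → SN P
  reduct (term (rule (inj₁ ())))
  reduct (term (rule (inj₂ ())))
  reduct (term (pairˡ q))         = SN-pair₁ {K = K} (m (⋆-↦ˡ K q)) (acc n)
  reduct (term (pairʳ q))         = SN-pair₁ {K = K} (acc m) (n q)
  reduct (stack (tail {L = L} q)) = SN-pair₁ {K = L} (m (⋆-↦ʳ M q)) (acc n)
  reduct (redex (inj₁ β-∧₁))      = acc m

SN-pair₂ : {M : Term Γ σ} {N : Term Γ τ} {K : Stack Γ τ ρ} →
           SN M → SN (N ⋆ K) → SN (⟨ M , N ⟩ ∙ π₂ ⋆ K)
SN-pair₂ {Γ = Γ} {ρ = ρ} {M = M} {N} {K} (acc m) (acc n) =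
  acc λ q → reduct (⋆-step ⟨ M , N ⟩ (π₂ ◅ K) q)
  where
  reduct : {P : Term Γ ρ} → ⋆-Step ⟨ M , N ⟩ (π₂ ◅ K) P → SN P
  reduct (term (rule (inj₁ ())))
  reduct (term (rule (inj₂ ())))
  reduct (term (pairˡ q))         = SN-pair₂ {K = K} (m q) (acc n)
  reduct (term (pairʳ q))         = SN-pair₂ {K = K} (acc m) (n (⋆-↦ˡ K q))
  reduct (stack (tail {L = L} q)) = SN-pair₂ {K = L} (acc m) (n (⋆-↦ʳ N q))
  reduct (redex (inj₁ β-∧₂))      = acc n

-- Head expansion again: the accessibility of the stack also bounds steps in the discarded branch
-- `T` and permutations, neither of which need change the contractum.
SN-in₁ : {A : Term Γ σ} {S : Term (σ ∷ Γ) δ} {T : Term (τ ∷ Γ) δ} {K : Stack Γ δ ρ} →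
         SN A → SNˢ (case S T ◅ K) → SN (S [ A ] ⋆ K) → SN (in₁ A ∙ case S T ⋆ K)
SN-in₁ {Γ = Γ} {ρ = ρ} {A = A} {S} {T} {K} (acc a) (acc k) x =
  acc λ q → reduct (⋆-step (in₁ A) (case S T ◅ K) q)
  where
  reduct : {P : Term Γ ρ} → ⋆-Step (in₁ A) (case S T ◅ K) P → SN P
  reduct (term (rule (inj₁ ())))
  reduct (term (rule (inj₂ ())))
  reduct (term (in₁ q)) =
    SN-in₁ {K = K} (a q) (acc k) (SN-↦* x (gmap (_⋆ K) (⋆-↦ˡ K) ([]-↦ʳ S q)))
  reduct (stack q@(head (caseˡ q′))) =
    SN-in₁ {K = K} (acc a) (k q) (acc-inverse x (⋆-↦ˡ K ([]-↦ˡ A q′)))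
  reduct (stack q@(head (caseʳ _))) = SN-in₁ {K = K} (acc a) (k q) x
  reduct (stack q@(tail {L = L} q′)) =
    SN-in₁ {K = L} (acc a) (k q) (acc-inverse x (⋆-↦ʳ (S [ A ]) q′))
  -- The contractum stays the same up to equality, so only the accessibility of the stack descends.
  reduct (stack (γ-∨ {E = E} {K = L})) =
    SN-in₁ {K = L} (acc a) (k γ-∨) (≡-subst SN (sym (∙-weaken-[] S A E L)) x)
  reduct (redex (inj₁ β-∨₁)) = x

SN-in₂ : {B : Term Γ τ} {S : Term (σ ∷ Γ) δ} {T : Term (τ ∷ Γ) δ} {K : Stack Γ δ ρ} →
         SN B → SNˢ (case S T ◅ K) → SN (T [ B ] ⋆ K) → SN (in₂ B ∙ case S T ⋆ K)
SN-in₂ {Γ = Γ} {ρ = ρ} {B = B} {S} {T} {K} (acc b) (acc k) y =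
  acc λ q → reduct (⋆-step (in₂ B) (case S T ◅ K) q)
  where
  reduct : {P : Term Γ ρ} → ⋆-Step (in₂ B) (case S T ◅ K) P → SN P
  reduct (term (rule (inj₁ ())))
  reduct (term (rule (inj₂ ())))
  reduct (term (in₂ q)) =
    SN-in₂ {K = K} (b q) (acc k) (SN-↦* y (gmap (_⋆ K) (⋆-↦ˡ K) ([]-↦ʳ T q)))
  reduct (stack q@(head (caseˡ _))) = SN-in₂ {K = K} (acc b) (k q) y
  reduct (stack q@(head (caseʳ q′))) =
    SN-in₂ {K = K} (acc b) (k q) (acc-inverse y (⋆-↦ˡ K ([]-↦ˡ B q′)))
  reduct (stack q@(tail {L = L} q′)) =
    SN-in₂ {K = L} (acc b) (k q) (acc-inverse y (⋆-↦ʳ (T [ B ]) q′))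
  reduct (stack (γ-∨ {E = E} {K = L})) =
    SN-in₂ {K = L} (acc b) (k γ-∨) (≡-subst SN (sym (∙-weaken-[] T B E L)) y)
  reduct (redex (inj₁ β-∨₂)) = y

-- Introductions in front of the empty stack

SN-lam-[] : {M : Term (σ ∷ Γ) τ} → SN M → SN (lam M)
SN-lam-[] (acc m) = acc λ
  { (rule (inj₁ ())) ; (rule (inj₂ ())) ; (lam q) → SN-lam-[] (m q) }

SN-pair-[] : {M : Term Γ σ} {N : Term Γ τ} → SN M → SN N → SN ⟨ M , N ⟩
SN-pair-[] (acc m) (acc n) = acc λ
  { (rule (inj₁ ())) ; (rule (inj₂ ()))
  ; (pairˡ q) → SN-pair-[] (m q) (acc n)
  ; (pairʳ q) → SN-pair-[] (acc m) (n q) }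

SN-in₁-[] : {M : Term Γ σ} → SN M → SN (in₁ {τ = τ} M)
SN-in₁-[] (acc m) = acc λ
  { (rule (inj₁ ())) ; (rule (inj₂ ())) ; (in₁ q) → SN-in₁-[] (m q) }

SN-in₂-[] : {M : Term Γ τ} → SN M → SN (in₂ {σ = σ} M)
SN-in₂-[] (acc m) = acc λ
  { (rule (inj₁ ())) ; (rule (inj₂ ())) ; (in₂ q) → SN-in₂-[] (m q) }

-- Reducibility

-- `Red σ` is the orthogonal of `Good σ` with respect to strong normalization of `M ⋆ K`. At a type
-- constant the empty stack is the only possible one.
Good : (σ : Ty Atom) → Stack Δ σ ρ → Set
Red  : (σ : Ty Atom) → Term Δ σ → Set

Good σ       []             = ⊤
Good (σ ⇒ τ) (app N ◅ K)    = Red σ N × Good τ K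
Good (σ ∧ τ) (π₁ ◅ K)       = Good σ K
Good (σ ∧ τ) (π₂ ◅ K)       = Good τ K
Good (σ ∨ τ) (case S T ◅ K) = (∀ A → Red σ A → SN (S [ A ] ⋆ K)) ×
                              (∀ B → Red τ B → SN (T [ B ] ⋆ K))
-- The type behind `ε` is arbitrary, so goodness cannot recur on it; since `ε` merely absorbs
-- eliminators, strong normalization of `K` suffices.
Good ⊥       (ε _ ◅ K)      = SNˢ K

Red {Δ = Δ} σ M = ∀ {ρ} (K : Stack Δ σ ρ) → Good σ K → SN (M ⋆ K)

Red⇒SN : {M : Term Δ σ} → Red σ M → SN M
Red⇒SN h = h [] tt

module _ {Δ : Ctx Atom} (z : ⊥ ∈ Δ) where

  any : (σ : Ty Atom) → Term Δ σ
  any σ = var z ∙ ε σ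

  SNˢ⇒SN-any : {K : Stack Δ σ ρ} → SNˢ K → SN (any σ ⋆ K)
  SNˢ⇒SN-any k = SN-var z (SNˢ-ε k)

  -- Simultaneous induction on the type: a good case analysis is tested at reducible arguments,
  -- which `Red-any` provides at the two smaller types.
  Good⇒SNˢ : (σ : Ty Atom) (K : Stack Δ σ ρ) → Good σ K → SNˢ K
  Red-any  : (σ : Ty Atom) → Red σ (any σ)

  Good⇒SNˢ σ       []             g       = SNˢ-[]
  Good⇒SNˢ (σ ⇒ τ) (app N ◅ K)    (n , g) = SNˢ-app (Red⇒SN n) (Good⇒SNˢ τ K g)
  Good⇒SNˢ (σ ∧ τ) (π₁ ◅ K)       g       = SNˢ-π₁ (Good⇒SNˢ σ K g)
  Good⇒SNˢ (σ ∧ τ) (π₂ ◅ K)       g       = SNˢ-π₂ (Good⇒SNˢ τ K g)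
  Good⇒SNˢ (σ ∨ τ) (case S T ◅ K) (f , g) =
    SNˢ-case K (any σ) (any τ) (f _ (Red-any σ)) (g _ (Red-any τ)) refl refl
  Good⇒SNˢ ⊥       (ε _ ◅ K)      g       = SNˢ-ε g

  Red-any σ K g = SNˢ⇒SN-any (Good⇒SNˢ σ K g)

  Red-var : (x : σ ∈ Δ) → Red σ (var x)
  Red-var {σ = σ} x K g = SN-var x (Good⇒SNˢ σ K g)

  RedSub : Sub Γ Δ → Set
  RedSub {Γ = Γ} s = ∀ {σ} (x : σ ∈ Γ) → Red σ (s x)

  RedSub-extend : {s : Sub Γ Δ} {A : Term Δ σ} → RedSub s → Red σ A → RedSub (extend A s)
  RedSub-extend h a (here refl) = a
  RedSub-extend h a (there x)   = h x

  -- Induction on the term, for all reducible closing substitutions. An introduction facing a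
  -- matching eliminator is handled by head expansion, and an elimination pushes its eliminator onto
  -- the stack, which has to stay good.
  fundamental  : (M : Term Γ σ) (s : Sub Γ Δ) → RedSub s → Red σ (subst s M)
  fundamentalE : (E : Elim Γ σ τ) (s : Sub Γ Δ) → RedSub s →
                 (K : Stack Δ τ ρ) → Good τ K → Good σ (substE s E ◅ K)
  fundamental-[] : (M : Term (σ ∷ Γ) τ) (s : Sub Γ Δ) → RedSub s →
                   (A : Term Δ σ) → Red σ A → Red τ (subst (liftSub s) M [ A ])

  fundamental-SN : (M : Term (σ ∷ Γ) τ) (s : Sub Γ Δ) → RedSub s →
                   SN (subst (liftSub s) M)

  fundamental-[] M s h A a
    rewrite subst-liftSub-[] s M A = fundamental M (extend A s) (RedSub-extend h a)

  fundamental-SN {σ = σ} M s h =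
    SN-reflect ([]-↦ˡ (any σ)) (Red⇒SN (fundamental-[] M s h (any σ) (Red-any σ)))

  fundamental (var x) s h = h x
  fundamental (lam M) s h [] g = SN-lam-[] (fundamental-SN M s h)
  fundamental (lam {σ = σ} {τ} M) s h (app A ◅ K) (a , g) =
    SN-lam {K = K} (fundamental-SN M s h)
      (Good⇒SNˢ (σ ⇒ τ) (app A ◅ K) (a , g)) (fundamental-[] M s h A a K g)
  fundamental ⟨ M , N ⟩ s h [] g =
    SN-pair-[] (Red⇒SN (fundamental M s h)) (Red⇒SN (fundamental N s h))
  fundamental ⟨ M , N ⟩ s h (π₁ ◅ K) g =
    SN-pair₁ {K = K} (fundamental M s h K g) (Red⇒SN (fundamental N s h))
  fundamental ⟨ M , N ⟩ s h (π₂ ◅ K) g =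
    SN-pair₂ {K = K} (Red⇒SN (fundamental M s h)) (fundamental N s h K g)
  fundamental (in₁ M) s h [] g = SN-in₁-[] (Red⇒SN (fundamental M s h))
  fundamental (in₁ {σ = σ} {τ} M) s h (case S T ◅ K) (f , g) =
    SN-in₁ {K = K} (Red⇒SN (fundamental M s h))
      (Good⇒SNˢ (σ ∨ τ) (case S T ◅ K) (f , g)) (f _ (fundamental M s h))
  fundamental (in₂ M) s h [] g = SN-in₂-[] (Red⇒SN (fundamental M s h))
  fundamental (in₂ {τ = τ} {σ} M) s h (case S T ◅ K) (f , g) =
    SN-in₂ {K = K} (Red⇒SN (fundamental M s h))
      (Good⇒SNˢ (σ ∨ τ) (case S T ◅ K) (f , g)) (g _ (fundamental M s h))
  fundamental (M ∙ E) s h K g =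
    fundamental M s h (substE s E ◅ K) (fundamentalE E s h K g)

  fundamentalE (app N)    s h K g = fundamental N s h , g
  fundamentalE π₁         s h K g = g
  fundamentalE π₂         s h K g = g
  -- The branches are reducible at the result type after instantiation, and `K` is good at that
  -- type, so the two meet in a strongly normalizing term.
  fundamentalE (case S T) s h K g =
    (λ A a → fundamental-[] S s h A a K g) , (λ B b → fundamental-[] T s h B b K g)
  fundamentalE (ε τ)      s h K g = Good⇒SNˢ τ K g

-- Strong normalization and absence of infinite reductions

-- `Γ` may lack a variable of type `⊥`, so one is adjoined; weakening preserves steps, hence strong
-- normalization comes back to `M`.
strongly-normalizing : (M : Term Γ σ) → SN M
strongly-normalizing {Γ = Γ} M =
  SN-reflect (subst-↦ s) (Red⇒SN (fundamental z M s (Red-var z ∘ there)))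
  where
  z : ⊥ ∈ ⊥ ∷ Γ
  z = here refl
  s : Sub Γ (⊥ ∷ Γ)
  s x = var (there x)

theorem14 : (Atom : Set) (Γ : Ctx Atom) (σ : Ty Atom) (M : Term Γ σ) →
    ¬ (Σ[ Ms ∈ (ℕ → Term Γ σ) ] (Ms zero ≡ M × (∀ n → Ms n ⟶ Ms (suc n))))
theorem14 Atom Γ σ M (Ms , refl , steps) =
  -- Every term of the sequence has a `↦`-reduct that is again in the sequence, so no accessible
  -- term can belong to it, whereas `M` does.
  descent∧acc⇒unsatisfiable {P = λ N → Σ[ n ∈ ℕ ] Ms n ≡ N}
    (λ { (n , refl) → Ms (suc n) , ⟶⇒↦ (steps n) , suc n , refl })
    (strongly-normalizing M) (zero , refl)
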